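{- For every integer $n\ge 1$, $$\mathrm{pf}_n(231,321)=\frac{\binom{3n}{n}}{2n+1}.$$
   Context: A Dyck path of semilength $n$ is a lattice path from $(0,0)$ to $(n,n)$ consisting of $n$ north steps $N=(0,1)$ and $n$ east steps $E=(1,0)$ that never goes below the line $y=x$. A parking function of size $n$ is a Dyck path of semilength $n$ whose $n$ north steps are labeled bijectively by $\{1,\dots,n\}$ so that whenever two north steps are consecutive in the path (one immediately following the other), the label of the later one is larger. For a parking function $p$ of size $n$, $\phi(p)$ is the permutation of $\{1,\dots,n\}$ (in one-line notation) obtained by reading the labels of the north steps in the order they occur along the path. A permutation $\pi$ of $\{1,\dots,n\}$ contains a permutation $\rho$ of $\{1,\dots,m\}$ if there are indices $1\le i_1<\cdots<i_m\le n$ such that $\pi_{i_a}\le\pi_{i_b}$ if and only if $\rho_a\le\rho_b$; otherwise $\pi$ avoids $\rho$. For permutations $\rho_1,\dots,\rho_r$, $\mathrm{pf}_n(\rho_1,\dots,\rho_r)$ denotes the number of parking functions $p$ of size $n$ such that $\phi(p)$ avoids each of $\rho_1,\dots,\rho_r$. -}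

module Defs where

open import Data.Fin using (Fin; _<_; _≤_)
open import Data.Fin.Patterns using (0F; 1F; 2F)
open import Data.Fin.Properties using (_≟_; _<?_; _≤?_; any?; all?)
open import Data.List using (List; []; _∷_; length; lookup; map; filter; inits; allFin; cartesianProductWith)
open import Data.List.Membership.Propositional using (_∈_)
open import Data.List.Membership.Propositional.Properties
  using (∈-map⁺; ∈-allFin; ∈-cartesianProductWith⁺; ∈-filter⁺; ∈-filter⁻)
open import Data.List.Relation.Unary.All as All using (All)
open import Data.List.Relation.Unary.AllPairs using ([]; _∷_)
open import Data.List.Relation.Unary.Any using (here; there)
open import Data.List.Relation.Unary.Linked using (Linked; linked?)
open import Data.List.Relation.Unary.Unique.Propositional using (Unique)
import Data.List.Relation.Unary.All.Properties as All
import Data.List.Relation.Unary.Unique.Propositional.Properties as Unique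
open import Data.Nat as ℕ using (ℕ; zero; suc; _+_)
open import Data.Nat.Properties as ℕ using (+-suc)
open import Data.Product using (∃; _×_; _,_; proj₁; proj₂)
open import Data.Product.Properties using (≡-dec)
open import Data.Unit using (⊤; tt)
open import Data.Vec as Vec using (Vec; []; _∷_)
open import Function using (_∘_; _⇔_; mk⇔; Equivalence; Bijective)
open import Relation.Binary.PropositionalEquality using (_≡_; refl; sym; trans; cong; cong₂; subst)
open import Relation.Nullary using (¬_; Dec; yes)
open import Relation.Nullary.Decidable using (map′; ¬?; _×-dec_; _→-dec_; from-yes)
open import Relation.Unary using (Pred; Decidable)

-- Permutations in one-line notation. Labels and values are taken from
-- Fin n = {0,…,n-1} in place of {1,…,n}.

IsPermutation : ∀ {n} → List (Fin n) → Set
IsPermutation π = Bijective _≡_ _≡_ (lookup π)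

record Permutation (n : ℕ) : Set where
  field
    oneLine       : List (Fin n)
    isPermutation : IsPermutation oneLine

open Permutation public

-- The indices are positions in π, increasing from left to right.

Contains : ∀ {n m} → List (Fin n) → List (Fin m) → Set
Contains π ρ = ∃ λ (i : Vec (Fin (length π)) (length ρ)) →
  (∀ a b → a < b → Vec.lookup i a < Vec.lookup i b) ×
  (∀ a b → (lookup π (Vec.lookup i a) ≤ lookup π (Vec.lookup i b)) ⇔ (lookup ρ a ≤ lookup ρ b))

Avoids : ∀ {n} → List (Fin n) → ∃ Permutation → Set
Avoids π (_ , ρ) = ¬ Contains π (oneLine ρ)

-- Lattice paths from the origin whose north steps carry labels.

data Step (n : ℕ) : Set where
  N : (label : Fin n) → Step n
  E : Step n

endpoint : ∀ {n} → List (Step n) → ℕ × ℕ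
endpoint []        = 0 , 0
endpoint (N _ ∷ p) = proj₁ (endpoint p) , suc (proj₂ (endpoint p))
endpoint (E ∷ p)   = suc (proj₁ (endpoint p)) , proj₂ (endpoint p)

WeaklyAboveDiagonal : ℕ × ℕ → Set
WeaklyAboveDiagonal (x , y) = x ℕ.≤ y

IsDyckPath : ∀ {n} → List (Step n) → Set
IsDyckPath {n} p = endpoint p ≡ (n , n) × All (WeaklyAboveDiagonal ∘ endpoint) (inits p)

φ : ∀ {n} → List (Step n) → List (Fin n)
φ []        = []
φ (N i ∷ p) = i ∷ φ p
φ (E ∷ p)   = φ p

LabelsIncrease : ∀ {n} → Step n → Step n → Set
LabelsIncrease (N i) (N j) = i < j
LabelsIncrease (N _) E     = ⊤
LabelsIncrease E     _     = ⊤

IsParkingFunction : ∀ {n} → List (Step n) → Set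
IsParkingFunction p = IsDyckPath p × IsPermutation (φ p) × Linked LabelsIncrease p

IsAvoidingParkingFunction : ∀ {n} → List (∃ Permutation) → List (Step n) → Set
IsAvoidingParkingFunction ρs p = IsParkingFunction p × All (Avoids (φ p)) ρs

bijective? : ∀ {m n} (f : Fin m → Fin n) → Dec (Bijective _≡_ _≡_ f)
bijective? f =
  map′ (λ inj {x} {y} → inj x y) (λ inj x y → inj {x} {y})
    (all? λ x → all? λ y → (f x ≟ f y) →-dec (x ≟ y))
  ×-dec
  map′ (λ sur y → proj₁ (sur y) , λ { refl → proj₂ (sur y) })
       (λ sur y → proj₁ (sur y) , proj₂ (sur y) refl)
    (all? λ y → any? λ x → f x ≟ y)

isPermutation? : ∀ {n} → Decidable (IsPermutation {n})
isPermutation? π = bijective? (lookup π)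

anyVec? : ∀ {n p} m {P : Pred (Vec (Fin n) m) p} → Decidable P → Dec (∃ P)
anyVec? zero    P? = map′ ([] ,_) (λ { ([] , px) → px }) (P? [])
anyVec? (suc m) P? =
  map′ (λ { (i , is , px) → i ∷ is , px }) (λ { (i ∷ is , px) → i , is , px })
    (any? λ i → anyVec? m (P? ∘ (i ∷_)))

_⇔-dec_ : {A B : Set} → Dec A → Dec B → Dec (A ⇔ B)
a? ⇔-dec b? =
  map′ (λ (f , g) → mk⇔ f g) (λ e → Equivalence.to e , Equivalence.from e)
    ((a? →-dec b?) ×-dec (b? →-dec a?))

contains? : ∀ {n m} (π : List (Fin n)) (ρ : List (Fin m)) → Dec (Contains π ρ)
contains? π ρ = anyVec? (length ρ) λ i →
  (all? λ a → all? λ b → (a <? b) →-dec (Vec.lookup i a <? Vec.lookup i b))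
  ×-dec
  (all? λ a → all? λ b →
    (lookup π (Vec.lookup i a) ≤? lookup π (Vec.lookup i b)) ⇔-dec (lookup ρ a ≤? lookup ρ b))

isDyckPath? : ∀ {n} → Decidable (IsDyckPath {n})
isDyckPath? {n} p =
  ≡-dec ℕ._≟_ ℕ._≟_ (endpoint p) (n , n)
  ×-dec All.all? (λ q → proj₁ (endpoint q) ℕ.≤? proj₂ (endpoint q)) (inits p)

labelsIncrease? : ∀ {n} (s t : Step n) → Dec (LabelsIncrease s t)
labelsIncrease? (N i) (N j) = i <? j
labelsIncrease? (N _) E     = yes tt
labelsIncrease? E     _     = yes tt

isParkingFunction? : ∀ {n} → Decidable (IsParkingFunction {n})
isParkingFunction? p = isDyckPath? p ×-dec isPermutation? (φ p) ×-dec linked? labelsIncrease? p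

isAvoidingParkingFunction? : ∀ {n} ρs → Decidable (IsAvoidingParkingFunction {n} ρs)
isAvoidingParkingFunction? ρs p =
  isParkingFunction? p ×-dec All.all? (λ (_ , ρ) → ¬? (contains? (φ p) (oneLine ρ))) ρs

steps : ∀ n → List (Step n)
steps n = E ∷ map N (allFin n)

paths : ∀ n → ℕ → List (List (Step n))
paths n zero    = [] ∷ []
paths n (suc k) = cartesianProductWith _∷_ (steps n) (paths n k)

avoidingParkingFunctions : ∀ n → List (∃ Permutation) → List (List (Step n))
avoidingParkingFunctions n ρs = filter (isAvoidingParkingFunction? ρs) (paths n (n + n))

pf : ℕ → List (∃ Permutation) → ℕ
pf n ρs = length (avoidingParkingFunctions n ρs)

-- The list counted by pf contains every parking function that avoids ρs,
-- nothing else, and each exactly once.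

∈-steps : ∀ {n} (s : Step n) → s ∈ steps n
∈-steps (N i) = there (∈-map⁺ N (∈-allFin i))
∈-steps E     = here refl

∈-paths : ∀ {n} (p : List (Step n)) → p ∈ paths n (length p)
∈-paths []      = here refl
∈-paths (s ∷ p) = ∈-cartesianProductWith⁺ _∷_ (∈-steps s) (∈-paths p)

length-endpoint : ∀ {n} (p : List (Step n)) → length p ≡ proj₁ (endpoint p) + proj₂ (endpoint p)
length-endpoint []        = refl
length-endpoint (N _ ∷ p) = trans (cong suc (length-endpoint p)) (sym (+-suc _ _))
length-endpoint (E ∷ p)   = cong suc (length-endpoint p)

∈-avoidingParkingFunctions : ∀ {n} ρs (p : List (Step n)) →
  p ∈ avoidingParkingFunctions n ρs ⇔ IsAvoidingParkingFunction ρs p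
∈-avoidingParkingFunctions {n} ρs p = mk⇔
  (proj₂ ∘ ∈-filter⁻ (isAvoidingParkingFunction? ρs) {xs = paths n (n + n)})
  (λ avoiding@(((end , _) , _) , _) →
    ∈-filter⁺ (isAvoidingParkingFunction? ρs)
      (subst (λ k → p ∈ paths n k)
        (trans (length-endpoint p) (cong₂ _+_ (cong proj₁ end) (cong proj₂ end)))
        (∈-paths p))
      avoiding)

steps-unique : ∀ n → Unique (steps n)
steps-unique n =
  All.map⁺ (All.tabulate λ _ ()) ∷ Unique.map⁺ (λ { refl → refl }) (Unique.allFin⁺ n)

paths-unique : ∀ n k → Unique (paths n k)
paths-unique n zero    = All.[] ∷ []
paths-unique n (suc k) =
  Unique.cartesianProductWith⁺ _∷_ (λ { refl → refl , refl }) (steps-unique n) (paths-unique n k)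

avoidingParkingFunctions-unique : ∀ n ρs → Unique (avoidingParkingFunctions n ρs)
avoidingParkingFunctions-unique n ρs =
  Unique.filter⁺ (isAvoidingParkingFunction? ρs) (paths-unique n (n + n))

ρ₂₃₁ ρ₃₂₁ : ∃ Permutation
ρ₂₃₁ = 3 , record { oneLine = π ; isPermutation = from-yes (isPermutation? π) }
  where π = 1F ∷ 2F ∷ 0F ∷ []
ρ₃₂₁ = 3 , record { oneLine = π ; isPermutation = from-yes (isPermutation? π) }
  where π = 2F ∷ 1F ∷ 0F ∷ []

{-# OPTIONS --safe #-}
-- Avoiding 231 and 321 means that every label has at most one larger label
-- before it, so the word of labels splits into blocks c, m, m+1, ..., c-1.
-- Reading the path step by step, it suffices to remember the height, the least
-- unused label m and the label c of an unfinished block. Summed over c, the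
-- numbers of completions satisfy linear recurrences in the height h and the
-- number r of unused labels, which are solved by alternating sums of powers of
-- the series T = 1 + x T³; at height 0 what remains is T itself, and its
-- coefficients are C(3n,n)/(2n+1).
module Submission where

open import Defs
open import Data.Bool using (true; false)
open import Data.Empty using (⊥; ⊥-elim)
open import Data.Fin as Fin using (Fin; zero; suc; toℕ; fromℕ<)
open import Data.Fin.Patterns using (0F; 1F; 2F)
open import Data.Fin.Properties using (toℕ-injective; toℕ-fromℕ<; toℕ<n; injective⇒≤)
open import Data.Integer using (+_)
import Data.Integer as ℤ
import Data.Integer.Properties as ℤ
open import Data.List using (_∷_; [])
open import Data.List
  using (List; _++_; length; lookup; map; filter; inits; tabulate; allFin; cartesianProductWith)
open import Data.List.Membership.Propositional using (_∈_)
open import Data.List.Membership.Propositional.Properties using (∈-lookup)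
open import Data.List.Properties
  using (filter-++; filter-accept; filter-≐; filter-none; length-++;
    map-cong; map-tabulate; map-∘; tabulate-lookup)
open import Data.List.Relation.Unary.All as All using (All; []; _∷_)
import Data.List.Relation.Unary.All.Properties as All
open import Data.List.Relation.Unary.AllPairs using ([]; _∷_)
open import Data.List.Relation.Unary.Any as Any using (here; there)
open import Data.List.Relation.Unary.Any.Properties using (lookup-index)
open import Data.List.Relation.Unary.Linked as Linked using (Linked; []; [-]; _∷_)
open import Data.List.Relation.Unary.Unique.Propositional using (Unique)
import Data.List.Relation.Unary.Unique.Propositional.Properties as Unique
open import Data.Nat using (ℕ; _≥_; _+_; _*_)
open import Data.Nat using (zero; suc; z≤n; s≤s; _≤_; _<_; _≟_; _≤?_)
open import Data.Nat.Combinatorics using (_C_; nCk+nC[k+1]≡[n+1]C[k+1])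
open import Data.Nat.ListAction using (sum)
open import Data.Nat.Properties
open import Data.Nat.Tactic.RingSolver using (solve-∀)
open import Data.Product using (_×_; _,_; proj₁; proj₂)
open import Data.Rational using (_/_)
open import Data.Rational.Properties using (fromℚᵘ-cong)
open import Data.Rational.Unnormalised using (mkℚᵘ; *≡*)
open import Data.Unit using (tt)
import Data.Vec as Vec
open import Function using (_∘_; id; _⇔_; mk⇔; Equivalence; Injective)
open import Relation.Binary.Definitions using (Tri; tri<; tri≈; tri>)
open import Relation.Binary.PropositionalEquality using (_≡_)
open import Relation.Binary.PropositionalEquality
  using (_≢_; refl; sym; trans; cong; cong₂; subst; subst₂; module ≡-Reasoning)
open import Relation.Nullary using (¬_; Dec; yes; no; contradiction; does)
open import Relation.Nullary.Decidable using (map′; _×-dec_)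
open import Relation.Unary using (Decidable)
open Equivalence using (to; from)
open ≡-Reasoning

private
  variable
    n : ℕ

-- Finite sums of natural numbers

Σ[_]_ : ℕ → (ℕ → ℕ) → ℕ
Σ[ zero  ] f = 0
Σ[ suc n ] f = f 0 + Σ[ n ] (λ j → f (suc j))

Σ-zero : ∀ n → Σ[ n ] (λ _ → 0) ≡ 0
Σ-zero zero    = refl
Σ-zero (suc n) = Σ-zero n

Σ-+ : ∀ n f g → Σ[ n ] (λ j → f j + g j) ≡ Σ[ n ] f + Σ[ n ] g
Σ-+ zero    f g = refl
Σ-+ (suc n) f g = begin
  f 0 + g 0 + Σ[ n ] (λ j → f (suc j) + g (suc j))
    ≡⟨ cong (λ a → f 0 + g 0 + a) (Σ-+ n _ _) ⟩
  f 0 + g 0 + (Σ[ n ] (λ j → f (suc j)) + Σ[ n ] (λ j → g (suc j)))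
    ≡⟨ interchange (f 0) (g 0) _ _ ⟩
  f 0 + Σ[ n ] (λ j → f (suc j)) + (g 0 + Σ[ n ] (λ j → g (suc j))) ∎
  where
  interchange : ∀ a b c d → a + b + (c + d) ≡ a + c + (b + d)
  interchange = solve-∀

-- Raney numbers and their closed form

-- The coefficient of xʳ in Tᵏ, where T = 1 + x T³.
raney : ℕ → ℕ → ℕ
raney k       zero    = 1
raney zero    (suc r) = 0
raney (suc k) (suc r) = raney k (suc r) + raney (3 + k) r

-- The binomial coefficient with lower index k - 1, set to 0 at k = 0 so that Pascal's rule holds
-- for every k.
_C⁻_ : ℕ → ℕ → ℕ
n C⁻ zero  = 0
n C⁻ suc k = n C k

pascal : ∀ n k → suc n C k ≡ n C k + n C⁻ k
pascal n zero    = refl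
pascal n (suc k) = trans (sym (nCk+nC[k+1]≡[n+1]C[k+1] n k)) (+-comm (n C k) _)

[1+k]*[1+n]C[1+k]≡[1+n]*nCk : ∀ n k → suc k * (suc n C suc k) ≡ suc n * (n C k)
[1+k]*[1+n]C[1+k]≡[1+n]*nCk zero    zero    = refl
[1+k]*[1+n]C[1+k]≡[1+n]*nCk zero    (suc k) = *-zeroʳ k
[1+k]*[1+n]C[1+k]≡[1+n]*nCk (suc n) zero    = begin
  1 * (suc (suc n) C 1)              ≡⟨ cong (1 *_) (pascal (suc n) 1) ⟩
  1 * (suc n C 1 + 1)                ≡⟨ *-distribˡ-+ 1 (suc n C 1) 1 ⟩
  1 * (suc n C 1) + 1                ≡⟨ cong (_+ 1) ([1+k]*[1+n]C[1+k]≡[1+n]*nCk n 0) ⟩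
  suc n * 1 + 1                      ≡⟨ +-comm (suc n * 1) 1 ⟩
  suc (suc n) * 1                    ∎
[1+k]*[1+n]C[1+k]≡[1+n]*nCk (suc n) (suc k) = begin
  suc (suc k) * (suc (suc n) C suc (suc k))
    ≡⟨ cong (suc (suc k) *_) (pascal (suc n) (suc (suc k))) ⟩
  suc (suc k) * (suc n C suc (suc k) + suc n C suc k)
    ≡⟨ regroup k (suc n C suc (suc k)) (suc n C suc k) ⟩
  suc (suc k) * (suc n C suc (suc k)) + suc k * (suc n C suc k) + suc n C suc k
    ≡⟨ cong₂ (λ a b → a + b + suc n C suc k)
         ([1+k]*[1+n]C[1+k]≡[1+n]*nCk n (suc k)) ([1+k]*[1+n]C[1+k]≡[1+n]*nCk n k) ⟩
  suc n * (n C suc k) + suc n * (n C k) + suc n C suc k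
    ≡⟨ cong (_+ suc n C suc k) (*-distribˡ-+ (suc n) (n C suc k) (n C k)) ⟨
  suc n * (n C suc k + n C k) + suc n C suc k
    ≡⟨ cong (λ a → suc n * a + suc n C suc k) (pascal n (suc k)) ⟨
  suc n * (suc n C suc k) + suc n C suc k
    ≡⟨ +-comm (suc n * (suc n C suc k)) _ ⟩
  suc (suc n) * (suc n C suc k) ∎
  where
  regroup : ∀ k a b → suc (suc k) * (a + b) ≡ suc (suc k) * a + suc k * b + b
  regroup = solve-∀

-- The usual ratio of neighbouring binomials, with the upper index written as k + m to avoid
-- subtraction. Adding `suc k * ((k + m) C k)` to both sides reduces it to the preceding identity
-- through Pascal's rule.
absorption : ∀ m k → suc k * ((k + m) C suc k) ≡ m * ((k + m) C k)
absorption m k = +-cancelʳ-≡ (suc k * ((k + m) C k)) _ _ (begin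
  suc k * ((k + m) C suc k) + suc k * ((k + m) C k)
    ≡⟨ *-distribˡ-+ (suc k) ((k + m) C suc k) ((k + m) C k) ⟨
  suc k * ((k + m) C suc k + (k + m) C k)
    ≡⟨ cong (suc k *_) (pascal (k + m) (suc k)) ⟨
  suc k * (suc (k + m) C suc k)
    ≡⟨ [1+k]*[1+n]C[1+k]≡[1+n]*nCk (k + m) k ⟩
  suc (k + m) * ((k + m) C k)
    ≡⟨ split k m ((k + m) C k) ⟩
  m * ((k + m) C k) + suc k * ((k + m) C k) ∎)
  where
  split : ∀ k m a → suc (k + m) * a ≡ m * a + suc k * a
  split = solve-∀

-- The classical k/(3r+k) C(3r+k, r), freed of division and subtraction.
raney-closed : ∀ k r → raney (suc k) r + 2 * ((k + 3 * r) C⁻ r) ≡ (k + 3 * r) C r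
raney-closed k       zero    = refl
raney-closed zero    (suc r) = begin
  raney 3 r + 2 * ((3 * suc r) C r)
    ≡⟨ cong (λ N → raney 3 r + 2 * (N C r)) N≡ ⟩
  raney 3 r + 2 * (suc M C r)
    ≡⟨ cong (λ a → raney 3 r + 2 * a) (pascal M r) ⟩
  raney 3 r + 2 * (M C r + M C⁻ r)
    ≡⟨ regroup (raney 3 r) (M C r) (M C⁻ r) ⟩
  (raney 3 r + 2 * (M C⁻ r)) + 2 * (M C r)
    ≡⟨ cong (_+ 2 * (M C r)) (raney-closed 2 r) ⟩
  M C r + 2 * (M C r)
    ≡⟨ +-comm (M C r) _ ⟩
  2 * (M C r) + M C r
    ≡⟨ cong (_+ M C r) M-absorption ⟨
  M C suc r + M C r
    ≡⟨ pascal M (suc r) ⟨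
  suc M C suc r
    ≡⟨ cong (_C suc r) N≡ ⟨
  (3 * suc r) C suc r ∎
  where
  M = 2 + 3 * r
  N≡ : 3 * suc r ≡ suc M
  N≡ = *-suc 3 r
  M≡ : M ≡ r + suc r * 2
  M≡ = arith r
    where
    arith : ∀ r → 2 + 3 * r ≡ r + suc r * 2
    arith = solve-∀
  -- Since M - r = 2 (r + 1), the ratio of these neighbours is exactly 2, the factor in the closed
  -- form.
  M-absorption : M C suc r ≡ 2 * (M C r)
  M-absorption = *-cancelˡ-≡ _ _ (suc r) (begin
    suc r * (M C suc r)               ≡⟨ cong (λ N → suc r * (N C suc r)) M≡ ⟩
    suc r * ((r + suc r * 2) C suc r) ≡⟨ absorption (suc r * 2) r ⟩
    suc r * 2 * ((r + suc r * 2) C r) ≡⟨ cong (λ N → suc r * 2 * (N C r)) M≡ ⟨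
    suc r * 2 * (M C r)               ≡⟨ *-assoc (suc r) 2 (M C r) ⟩
    suc r * (2 * (M C r))             ∎)
  regroup : ∀ a b c → a + 2 * (b + c) ≡ (a + 2 * c) + 2 * b
  regroup = solve-∀
raney-closed (suc k) (suc r) = begin
  raney (suc k) (suc r) + raney (4 + k) r + 2 * (suc M C r)
    ≡⟨ cong (λ a → raney (suc k) (suc r) + raney (4 + k) r + 2 * a) (pascal M r) ⟩
  raney (suc k) (suc r) + raney (4 + k) r + 2 * (M C r + M C⁻ r)
    ≡⟨ regroup (raney (suc k) (suc r)) (raney (4 + k) r) (M C r) (M C⁻ r) ⟩
  (raney (suc k) (suc r) + 2 * (M C r)) + (raney (4 + k) r + 2 * (M C⁻ r))
    ≡⟨ cong₂ _+_ (raney-closed k (suc r)) shifted ⟩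
  M C suc r + M C r
    ≡⟨ pascal M (suc r) ⟨
  suc M C suc r ∎
  where
  M = k + 3 * suc r
  M≡ : M ≡ 3 + k + 3 * r
  M≡ = arith k r
    where
    arith : ∀ k r → k + 3 * suc r ≡ 3 + k + 3 * r
    arith = solve-∀
  shifted : raney (4 + k) r + 2 * (M C⁻ r) ≡ M C r
  shifted = subst (λ N → raney (4 + k) r + 2 * (N C⁻ r) ≡ N C r) (sym M≡) (raney-closed (3 + k) r)
  regroup : ∀ a b c d → a + b + 2 * (c + d) ≡ (a + 2 * c) + (b + 2 * d)
  regroup = solve-∀

-- The closed form at k = 0 multiplied by 2n + 1; absorption turns (2n + 1) C(3n, n - 1) into n
-- C(3n, n), and 2n copies of C(3n, n) cancel.
[1+2n]*raney₁≡[3n]Cn : ∀ n → (1 + 2 * n) * raney 1 n ≡ (3 * n) C n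
[1+2n]*raney₁≡[3n]Cn zero    = refl
[1+2n]*raney₁≡[3n]Cn (suc r) = +-cancelʳ-≡ (2 * (suc r * (M C suc r))) _ _ (begin
  (1 + 2 * suc r) * raney 1 (suc r) + 2 * (suc r * (M C suc r))
    ≡⟨ cong (λ a → (1 + 2 * suc r) * raney 1 (suc r) + 2 * a) M-absorption ⟩
  (1 + 2 * suc r) * raney 1 (suc r) + 2 * ((1 + 2 * suc r) * (M C r))
    ≡⟨ factor r (raney 1 (suc r)) (M C r) ⟩
  (1 + 2 * suc r) * (raney 1 (suc r) + 2 * (M C r))
    ≡⟨ cong ((1 + 2 * suc r) *_) (raney-closed 0 (suc r)) ⟩
  (1 + 2 * suc r) * (M C suc r)
    ≡⟨ expand r (M C suc r) ⟩
  M C suc r + 2 * (suc r * (M C suc r)) ∎)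
  where
  M = 3 * suc r
  M≡ : M ≡ r + (1 + 2 * suc r)
  M≡ = arith r
    where
    arith : ∀ r → 3 * suc r ≡ r + (1 + 2 * suc r)
    arith = solve-∀
  M-absorption : suc r * (M C suc r) ≡ (1 + 2 * suc r) * (M C r)
  M-absorption = begin
    suc r * (M C suc r)                       ≡⟨ cong (λ N → suc r * (N C suc r)) M≡ ⟩
    suc r * ((r + (1 + 2 * suc r)) C suc r)   ≡⟨ absorption (1 + 2 * suc r) r ⟩
    (1 + 2 * suc r) * ((r + (1 + 2 * suc r)) C r) ≡⟨ cong (λ N → (1 + 2 * suc r) * (N C r)) M≡ ⟨
    (1 + 2 * suc r) * (M C r)                 ∎
  factor : ∀ r a b → (1 + 2 * suc r) * a + 2 * ((1 + 2 * suc r) * b) ≡ (1 + 2 * suc r) * (a + 2 * b)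
  factor = solve-∀
  expand : ∀ r a → (1 + 2 * suc r) * a ≡ a + 2 * (suc r * a)
  expand = solve-∀

-- The recurrences and their solution

-- completions j h r counts the ways to complete a path at height h with r
-- labels unused, of which the next j are forced.
completions : ℕ → ℕ → ℕ → ℕ
completions zero    h       zero    = 1
completions (suc j) h       zero    = 0
completions zero    zero    (suc r) =
  completions 0 1 r + Σ[ r ] (λ j → completions (suc j) 0 r)
completions zero    (suc h) (suc r) =
  completions 0 h (suc r) + (completions 0 (2 + h) r + Σ[ r ] (λ j → completions (suc j) (suc h) r))
completions (suc j) zero    (suc r) = completions j 1 r
completions (suc j) (suc h) (suc r) = completions (suc j) h (suc r) + completions j (2 + h) r

unforced forced : ℕ → ℕ → ℕ
unforced h r = completions 0 h r
forced   h r = Σ[ r ] (λ j → completions (suc j) h r)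

-- A north step uses up one forced label, so the sum over j now starts at 0; its first term is the
-- unforced count.
forced-suc : ∀ h r → forced (suc h) (suc r) ≡ forced h (suc r) + (unforced (2 + h) r + forced (2 + h) r)
forced-suc h r = Σ-+ (suc r) (λ j → completions (suc j) h (suc r)) (λ j → completions j (2 + h) r)

-- Doubling that unfolds to two successors, so that the clauses of `raney` apply by computation.
double : ℕ → ℕ
double zero    = 0
double (suc h) = suc (suc (double h))

-- unforced h and forced h have the generating functions
-- T^(2h+1) - T^(2h) + ... + T and T^(2h+2) - T^(2h+1) + ... - T;
-- adding neighbours telescopes these alternating sums.
unforced+forced≡raney : ∀ h r → unforced h r + forced h r ≡ raney (2 + double h) r
unforced[1+h]+forced≡raney : ∀ h r → unforced (suc h) r + forced h r ≡ raney (3 + double h) r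

unforced+forced≡raney h       zero    = refl
unforced+forced≡raney zero    (suc r) =
  -- `raney 2 (suc r)` unfolds twice, to `raney 3 r + raney 4 r`.
  cong₂ _+_ (unforced[1+h]+forced≡raney 0 r) (unforced+forced≡raney 1 r)
unforced+forced≡raney (suc h) (suc r) = begin
  unforced (suc h) (suc r) + forced (suc h) (suc r)
    ≡⟨ cong (λ a → unforced (suc h) (suc r) + a) (forced-suc h r) ⟩
  unforced (suc h) (suc r) + (forced h (suc r) + (unforced (2 + h) r + forced (2 + h) r))
    ≡⟨ +-assoc (unforced (suc h) (suc r)) _ _ ⟨
  (unforced (suc h) (suc r) + forced h (suc r)) + (unforced (2 + h) r + forced (2 + h) r)
    ≡⟨ cong₂ _+_ (unforced[1+h]+forced≡raney h (suc r)) (unforced+forced≡raney (2 + h) r) ⟩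
  raney (3 + double h) (suc r) + raney (6 + double h) r ∎

unforced[1+h]+forced≡raney h zero    = refl
unforced[1+h]+forced≡raney h (suc r) = begin
  unforced h (suc r) + (unforced (2 + h) r + forced (suc h) r) + forced h (suc r)
    ≡⟨ regroup (unforced h (suc r)) _ (forced h (suc r)) ⟩
  (unforced h (suc r) + forced h (suc r)) + (unforced (2 + h) r + forced (suc h) r)
    ≡⟨ cong₂ _+_ (unforced+forced≡raney h (suc r)) (unforced[1+h]+forced≡raney (suc h) r) ⟩
  raney (2 + double h) (suc r) + raney (5 + double h) r ∎
  where
  regroup : ∀ a b c → a + b + c ≡ (a + c) + b
  regroup = solve-∀

-- At height 0 no east step is possible, so the first step already yields a sum of neighbours, with
-- series T³; this is the equation T = 1 + x T³.
unforced₀≡raney₁ : ∀ r → unforced 0 r ≡ raney 1 r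
unforced₀≡raney₁ zero    = refl
unforced₀≡raney₁ (suc r) = unforced[1+h]+forced≡raney 0 r

-- Words avoiding 231 and 321

lookup-injective : ∀ {A : Set} {xs : List A} → Unique xs → Injective _≡_ _≡_ (lookup xs)
lookup-injective (x∉xs ∷ _)   {zero}  {zero}  _  = refl
lookup-injective (x∉xs ∷ _)   {zero}  {suc j} eq = contradiction eq (All.lookup x∉xs (∈-lookup j))
lookup-injective (x∉xs ∷ _)   {suc i} {zero}  eq = contradiction (sym eq) (All.lookup x∉xs (∈-lookup i))
lookup-injective (_ ∷ unique) {suc i} {suc j} eq = cong suc (lookup-injective unique eq)

-- Both patterns end in their least entry and together they allow either order of the first two, so
-- avoiding both is one condition that ignores this order.
AtMostOneLargerBefore : List (Fin n) → Set
AtMostOneLargerBefore π = ∀ a b c → a Fin.< b → b Fin.< c →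
  lookup π c Fin.< lookup π a → lookup π c Fin.< lookup π b → ⊥

module _ {π : List (Fin n)} where

  contained-triple : ∀ {m} {x y z : Fin m} {a b c} →
    let ρ = x ∷ y ∷ z ∷ []; v = lookup π in
    a Fin.< b → b Fin.< c →
    ((v a Fin.≤ v b) ⇔ (x Fin.≤ y)) → ((v b Fin.≤ v a) ⇔ (y Fin.≤ x)) →
    ((v a Fin.≤ v c) ⇔ (x Fin.≤ z)) → ((v c Fin.≤ v a) ⇔ (z Fin.≤ x)) →
    ((v b Fin.≤ v c) ⇔ (y Fin.≤ z)) → ((v c Fin.≤ v b) ⇔ (z Fin.≤ y)) →
    Contains π ρ
  contained-triple {a = a} {b} {c} a<b b<c ab ba ac ca bc cb =
    is , increasing , isomorphic
    where
    is = a Vec.∷ b Vec.∷ c Vec.∷ Vec.[]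
    refl⇔ : ∀ {k l} {i : Fin k} {j : Fin l} → (i Fin.≤ i) ⇔ (j Fin.≤ j)
    refl⇔ = mk⇔ (λ _ → ≤-refl) (λ _ → ≤-refl)
    increasing : ∀ i j → i Fin.< j → Vec.lookup is i Fin.< Vec.lookup is j
    increasing 0F 1F _ = a<b
    increasing 0F 2F _ = <-trans a<b b<c
    increasing 1F 2F _ = b<c
    increasing 0F 0F ()
    increasing 1F 0F ()
    increasing 1F 1F (s≤s ())
    increasing 2F 0F ()
    increasing 2F 1F (s≤s ())
    increasing 2F 2F (s≤s (s≤s ()))
    isomorphic : ∀ i j → _ ⇔ _
    isomorphic 0F 0F = refl⇔
    isomorphic 0F 1F = ab
    isomorphic 0F 2F = ac
    isomorphic 1F 0F = ba
    isomorphic 1F 1F = refl⇔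
    isomorphic 1F 2F = bc
    isomorphic 2F 0F = ca
    isomorphic 2F 1F = cb
    isomorphic 2F 2F = refl⇔

  private
    both : ∀ {A B : Set} → A → B → A ⇔ B
    both x y = mk⇔ (λ _ → y) (λ _ → x)

    neither : ∀ {A B : Set} → ¬ A → ¬ B → A ⇔ B
    neither ¬x ¬y = mk⇔ (⊥-elim ∘ ¬x) (⊥-elim ∘ ¬y)

  -- Given two larger labels before a smaller one, their order decides which pattern occurs;
  -- uniqueness excludes a tie.
  avoids⇒atMostOneLargerBefore : Unique π → Avoids π ρ₂₃₁ → Avoids π ρ₃₂₁ → AtMostOneLargerBefore π
  avoids⇒atMostOneLargerBefore unique ¬231 ¬321 a b c a<b b<c c<a c<b
    with <-cmp (toℕ (lookup π a)) (toℕ (lookup π b))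
  ... | tri< va<vb _ _ = ¬231 (contained-triple a<b b<c
          (both (<⇒≤ va<vb) (s≤s z≤n)) (neither (<⇒≱ va<vb) λ { (s≤s ()) })
          (neither (<⇒≱ c<a) λ ()) (both (<⇒≤ c<a) z≤n)
          (neither (<⇒≱ c<b) λ ()) (both (<⇒≤ c<b) z≤n))
  ... | tri≈ _ va≡vb _ =
          <-irrefl (cong toℕ (lookup-injective unique {a} {b} (toℕ-injective va≡vb))) a<b
  ... | tri> _ _ vb<va = ¬321 (contained-triple a<b b<c
          (neither (<⇒≱ vb<va) λ { (s≤s ()) }) (both (<⇒≤ vb<va) (s≤s z≤n))
          (neither (<⇒≱ c<a) λ ()) (both (<⇒≤ c<a) z≤n)
          (neither (<⇒≱ c<b) λ ()) (both (<⇒≤ c<b) z≤n))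

  atMostOneLargerBefore⇒¬contains : ∀ {m} {x y z : Fin m} → z Fin.< x → z Fin.< y →
    AtMostOneLargerBefore π → ¬ Contains π (x ∷ y ∷ z ∷ [])
  atMostOneLargerBefore⇒¬contains z<x z<y sparse (a Vec.∷ b Vec.∷ c Vec.∷ Vec.[] , increasing , isomorphic) =
    sparse a b c (increasing 0F 1F (s≤s z≤n)) (increasing 1F 2F (s≤s (s≤s z≤n)))
      (≰⇒> (<⇒≱ z<x ∘ to (isomorphic 0F 2F))) (≰⇒> (<⇒≱ z<y ∘ to (isomorphic 1F 2F)))

-- w is an admissible continuation of a word that has used exactly the labels below m.
record Word (m : ℕ) (w : List (Fin n)) : Set where
  field
    unique   : Unique w
    lower    : All (λ i → m ≤ toℕ i) w
    complete : ∀ i → m ≤ toℕ i → i ∈ w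
    sparse   : AtMostOneLargerBefore w

open Word

avoidingPermutation⇔word : (π : List (Fin n)) →
  (IsPermutation π × All (Avoids π) (ρ₂₃₁ ∷ ρ₃₂₁ ∷ [])) ⇔ Word 0 π
avoidingPermutation⇔word π = mk⇔
  (λ { ((injective , surjective) , ¬231 ∷ ¬321 ∷ []) →
    let unique = subst Unique (tabulate-lookup π) (Unique.tabulate⁺ injective) in record
    { unique   = unique
    ; lower    = All.tabulate (λ _ → z≤n)
    ; complete = λ i _ → subst (_∈ π) (proj₂ (surjective i) refl) (∈-lookup (proj₁ (surjective i)))
    ; sparse   = avoids⇒atMostOneLargerBefore unique ¬231 ¬321 } })
  (λ word →
    ((λ {i} {j} → lookup-injective (unique word) {i} {j}) ,
     λ i → Any.index (complete word i z≤n) , λ { refl → sym (lookup-index (complete word i z≤n)) }) ,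
    atMostOneLargerBefore⇒¬contains {π = π} (s≤s z≤n) (s≤s z≤n) (sparse word) ∷
    atMostOneLargerBefore⇒¬contains {π = π} (s≤s z≤n) (s≤s z≤n) (sparse word) ∷ [])

length-permutation : {π : List (Fin n)} → IsPermutation π → length π ≡ n
length-permutation {π = π} (injective , surjective) = ≤-antisym (injective⇒≤ injective)
  (injective⇒≤ {f = λ i → proj₁ (surjective i)} λ {i} {j} eq →
    trans (sym (proj₂ (surjective i) refl)) (trans (cong (lookup π) eq) (proj₂ (surjective j) refl)))

module _ {m : ℕ} {i : Fin n} (i≡m : toℕ i ≡ m) where

  private
    bound⇒≢ : ∀ {j : Fin n} → suc m ≤ toℕ j → i ≢ j
    bound⇒≢ m<j refl = <-irrefl (sym i≡m) m<j

    bound-suc : ∀ {w} → All (i ≢_) w → All (λ j → m ≤ toℕ j) w → All (λ j → suc m ≤ toℕ j) w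
    bound-suc i∉w m≤w = All.zipWith
      (λ (i≢j , m≤j) → ≤∧≢⇒< m≤j (λ m≡j → i≢j (toℕ-injective (trans i≡m m≡j)))) (i∉w , m≤w)

    beyond : ∀ {w} {x : Fin n} → All (λ j → suc m ≤ toℕ j) w → x ∈ w → ¬ (x Fin.< i)
    beyond m<w x∈w x<i = <-asym (All.lookup m<w x∈w) (subst (_ <_) i≡m x<i)

  word-least : ∀ {w} → Word m (i ∷ w) ⇔ Word (suc m) w
  word-least {w} = mk⇔
    (λ { record { unique = i∉w ∷ unique ; lower = _ ∷ lower ; complete = complete ; sparse = sparse } → record
      { unique   = unique
      ; lower    = bound-suc i∉w lower
      ; complete = λ j m<j → drop m<j (complete j (<⇒≤ m<j))
      ; sparse   = λ a b c a<b b<c → sparse (suc a) (suc b) (suc c) (s≤s a<b) (s≤s b<c) } })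
    (λ word → record
      { unique   = All.map bound⇒≢ (lower word) ∷ unique word
      ; lower    = ≤-reflexive (sym i≡m) ∷ All.map <⇒≤ (lower word)
      ; complete = λ j m≤j → extend word j m≤j (m ≟ toℕ j)
      ; sparse   = sparse′ word })
    where
    drop : ∀ {j} → m < toℕ j → j ∈ i ∷ w → j ∈ w
    drop m<j (here refl) = contradiction refl (bound⇒≢ m<j)
    drop m<j (there j∈w) = j∈w
    extend : Word (suc m) w → ∀ j → m ≤ toℕ j → Dec (m ≡ toℕ j) → j ∈ i ∷ w
    extend word j m≤j (yes m≡j) = here (toℕ-injective (sym (trans i≡m m≡j)))
    extend word j m≤j (no m≢j)  = there (complete word j (≤∧≢⇒< m≤j m≢j))
    sparse′ : Word (suc m) w → AtMostOneLargerBefore (i ∷ w)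
    sparse′ word zero  b     (suc c) _ _ c<a _ = beyond (lower word) (∈-lookup c) c<a
    sparse′ word (suc a) (suc b) (suc c) (s≤s a<b) (s≤s b<c) = sparse word a b c a<b b<c

  -- Removes the label m from behind the larger label c. Keeping c at the head records that every
  -- later label below c already has its one larger predecessor.
  word-swap : ∀ {c w} → m < toℕ c → Word m (c ∷ i ∷ w) ⇔ Word (suc m) (c ∷ w)
  word-swap {c} {w} m<c = mk⇔
    (λ { record { unique = (_ ∷ c∉w) ∷ i∉w ∷ unique ; lower = _ ∷ _ ∷ lower
                ; complete = complete ; sparse = sparse } → record
      { unique   = c∉w ∷ unique
      ; lower    = m<c ∷ bound-suc i∉w lower
      ; complete = λ j m<j → drop m<j (complete j (<⇒≤ m<j))
      ; sparse   = sparse⁻ sparse } })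
    (λ { word@(record { unique = c∉w ∷ unique ; lower = _ ∷ lower }) → record
      { unique   = (bound⇒≢ m<c ∘ sym ∷ c∉w) ∷ All.map bound⇒≢ lower ∷ unique
      ; lower    = <⇒≤ m<c ∷ ≤-reflexive (sym i≡m) ∷ All.map <⇒≤ lower
      ; complete = λ j m≤j → extend word j m≤j (m ≟ toℕ j)
      ; sparse   = sparse⁺ word } })
    where
    drop : ∀ {j} → m < toℕ j → j ∈ c ∷ i ∷ w → j ∈ c ∷ w
    drop m<j (here j≡c)          = here j≡c
    drop m<j (there (here refl)) = contradiction refl (bound⇒≢ m<j)
    drop m<j (there (there j∈w)) = there j∈w
    extend : Word (suc m) (c ∷ w) → ∀ j → m ≤ toℕ j → Dec (m ≡ toℕ j) → j ∈ c ∷ i ∷ w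
    extend word j m≤j (yes m≡j) = there (here (toℕ-injective (sym (trans i≡m m≡j))))
    extend word j m≤j (no m≢j)  with complete word j (≤∧≢⇒< m≤j m≢j)
    ... | here j≡c  = here j≡c
    ... | there j∈w = there (there j∈w)
    sparse⁻ : AtMostOneLargerBefore (c ∷ i ∷ w) → AtMostOneLargerBefore (c ∷ w)
    sparse⁻ sparse zero    (suc b) (suc d) _         (s≤s b<d) =
      sparse zero (suc (suc b)) (suc (suc d)) (s≤s z≤n) (s≤s (s≤s b<d))
    sparse⁻ sparse (suc a) (suc b) (suc d) (s≤s a<b) (s≤s b<d) =
      sparse (suc (suc a)) (suc (suc b)) (suc (suc d)) (s≤s (s≤s a<b)) (s≤s (s≤s b<d))
    sparse⁺ : Word (suc m) (c ∷ w) → AtMostOneLargerBefore (c ∷ i ∷ w)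
    -- Only c precedes m, so m cannot be the last of three positions; as one of the first two it
    -- would have to exceed a later label.
    sparse⁺ word a             (suc zero)    (suc zero)    _ (s≤s ())
    sparse⁺ word a             (suc (suc b)) (suc zero)    _ (s≤s ())
    sparse⁺ word a             (suc zero)    (suc (suc d)) _ _ _ d<b =
      beyond (lower word) (there (∈-lookup d)) d<b
    sparse⁺ word (suc zero)    (suc (suc b)) (suc (suc d)) _ _ d<a _ =
      beyond (lower word) (there (∈-lookup d)) d<a
    sparse⁺ word zero          (suc (suc b)) (suc (suc d)) _ (s≤s (s≤s b<d)) =
      sparse word zero (suc b) (suc d) (s≤s z≤n) (s≤s b<d)
    sparse⁺ word (suc (suc a)) (suc (suc b)) (suc (suc d)) (s≤s (s≤s a<b)) (s≤s (s≤s b<d)) =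
      sparse word (suc a) (suc b) (suc d) (s≤s a<b) (s≤s b<d)

-- Otherwise the label m would come later, below both c and i.
word-forces-least : ∀ {m} {c i : Fin n} {w} → m < toℕ c → Word m (c ∷ i ∷ w) → toℕ i ≡ m
word-forces-least {n} {m} {c} {i} {w} m<c word with toℕ i ≟ m
... | yes i≡m = i≡m
... | no i≢m  = ⊥-elim (later (complete word least (≤-reflexive (sym least≡m))))
  where
  least = fromℕ< (<-trans m<c (toℕ<n c))
  least≡m : toℕ least ≡ m
  least≡m = toℕ-fromℕ< (<-trans m<c (toℕ<n c))
  m<i : m < toℕ i
  m<i = ≤∧≢⇒< (All.head (All.tail (lower word))) (i≢m ∘ sym)
  later : ¬ (least ∈ c ∷ i ∷ w)
  later (here eq)             = <-irrefl (trans (sym least≡m) (cong toℕ eq)) m<c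
  later (there (here eq))     = i≢m (trans (cong toℕ (sym eq)) least≡m)
  later (there (there least∈w)) = sparse word zero (suc zero) (suc (suc (Any.index least∈w)))
    (s≤s z≤n) (s≤s (s≤s z≤n)) (below m<c) (below m<i)
    where
    below : ∀ {k} → m < k → toℕ (lookup w (Any.index least∈w)) < k
    below = subst (_< _) (trans (sym least≡m) (cong toℕ (lookup-index least∈w)))

-- The label m would be missing: a path cannot stop inside an unfinished block.
¬word-singleton : ∀ {m} {c : Fin n} → m < toℕ c → ¬ Word m (c ∷ [])
¬word-singleton {m = m} {c} m<c word
  with complete word (fromℕ< (<-trans m<c (toℕ<n c))) (≤-reflexive (sym (toℕ-fromℕ< (<-trans m<c (toℕ<n c)))))
... | here eq = <-irrefl (trans (sym (toℕ-fromℕ< (<-trans m<c (toℕ<n c)))) (cong toℕ eq)) m<c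

word-[] : ∀ {m} → Word {n} m [] ⇔ n ≤ m
word-[] {n} {m} = mk⇔
  (λ word → ≮⇒≥ λ m<n → absurd (complete word (fromℕ< m<n) (≤-reflexive (sym (toℕ-fromℕ< m<n)))))
  (λ n≤m → record
    { unique = [] ; lower = []
    ; complete = λ i m≤i → contradiction (toℕ<n i) (≤⇒≯ (≤-trans n≤m m≤i))
    ; sparse = λ () })
  where
  absurd : ∀ {i : Fin n} → ¬ (i ∈ [])
  absurd ()

-- Path conditions on a suffix

-- The Dyck condition for a suffix that starts h units above the diagonal: it stays weakly above the
-- diagonal and ends on it. The endpoint of a suffix is its displacement.
Descent : ℕ → List (Step n) → Set
Descent h p = h + proj₂ (endpoint p) ≡ proj₁ (endpoint p) ×
  All (λ q → proj₁ (endpoint q) ≤ h + proj₂ (endpoint q)) (inits p)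

descent-N : ∀ h (i : Fin n) p → Descent h (N i ∷ p) ⇔ Descent (suc h) p
descent-N h i p = mk⇔
  (λ { (end , _ ∷ above) → trans (sym (+-suc h _)) end ,
    All.map (λ {q} → subst (proj₁ (endpoint q) ≤_) (+-suc h _)) (All.map⁻ above) })
  (λ { (end , above) → trans (+-suc h _) end ,
    z≤n ∷ All.map⁺ (All.map (λ {q} → subst (proj₁ (endpoint q) ≤_) (sym (+-suc h _))) above) })

descent-E : ∀ h (p : List (Step n)) → Descent (suc h) (E ∷ p) ⇔ Descent h p
descent-E h p = mk⇔
  (λ { (end , _ ∷ above) → suc-injective end , All.map ≤-pred (All.map⁻ above) })
  (λ { (end , above) → cong suc end , z≤n ∷ All.map⁺ (All.map s≤s above) })

¬descent-E : ∀ (p : List (Step n)) → ¬ Descent 0 (E ∷ p)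
¬descent-E p (_ , _ ∷ () ∷ _)

linked-E : ∀ (p : List (Step n)) → Linked LabelsIncrease p → Linked LabelsIncrease (E ∷ p)
linked-E []      _      = [-]
linked-E (s ∷ p) linked = tt ∷ linked

linked-N : ∀ (i : Fin n) p → All (i Fin.<_) (φ p) → Linked LabelsIncrease p → Linked LabelsIncrease (N i ∷ p)
linked-N i []        _         _      = [-]
linked-N i (N j ∷ p) (i<j ∷ _) linked = i<j ∷ linked
linked-N i (E ∷ p)   _         linked = tt ∷ linked

-- The automaton reading a path

-- The height and the labels m, m+1, ... (pending: except c) that remain.
-- The labels m, ..., c-1 have to follow the label c in this order; fresh
-- means that c is the label of the last step.
data State (n : ℕ) : Set where
  free          : (h m : ℕ) → State n
  fresh pending : (h m : ℕ) (c : Fin n) → State n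
  dead          : State n

-- The language accepted from each state. The label c has been read but stays at the head of the
-- word; `fresh` also keeps its north step, to compare c with a label following at once.
⟦_⟧ : State n → List (Step n) → Set
⟦ free h m ⟧      p = Descent h p × Word m (φ p) × Linked LabelsIncrease p
⟦ fresh h m c ⟧   p = Descent h p × (m < toℕ c × Word m (c ∷ φ p)) × Linked LabelsIncrease (N c ∷ p)
⟦ pending h m c ⟧ p = Descent h p × (m < toℕ c × Word m (c ∷ φ p)) × Linked LabelsIncrease p
⟦ dead ⟧          p = ⊥

freeStep : ∀ h m (i : Fin n) → Tri (toℕ i < m) (toℕ i ≡ m) (m < toℕ i) → State n
freeStep h m i (tri< _ _ _) = dead
freeStep h m i (tri≈ _ _ _) = free (suc h) (suc m)
freeStep h m i (tri> _ _ _) = fresh (suc h) m i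

pendingStep : ∀ h m (c i : Fin n) → Dec (toℕ i ≡ m) → Dec (toℕ c ≡ suc m) → State n
pendingStep h m c i (no _)  _       = dead
pendingStep h m c i (yes _) (yes _) = free (suc h) (2 + m)
pendingStep h m c i (yes _) (no _)  = pending (suc h) (suc m) c

δ : Step n → State n → State n
δ E     (free zero m)         = dead
δ E     (free (suc h) m)      = free h m
δ E     (fresh zero m c)      = dead
δ E     (fresh (suc h) m c)   = pending h m c
δ E     (pending zero m c)    = dead
δ E     (pending (suc h) m c) = pending h m c
δ E     dead                  = dead
δ (N i) (free h m)            = freeStep h m i (<-cmp (toℕ i) m)
δ (N i) (fresh h m c)         = dead
δ (N i) (pending h m c)       = pendingStep h m c i (toℕ i ≟ m) (toℕ c ≟ suc m)
δ (N i) dead                  = dead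

freeStep-correct : ∀ h m (i : Fin n) p cmp → ⟦ free h m ⟧ (N i ∷ p) ⇔ ⟦ freeStep h m i cmp ⟧ p
freeStep-correct h m i p (tri< i<m _ _) = mk⇔
  (λ (_ , word , _) → <⇒≱ i<m (All.head (lower word))) ⊥-elim
freeStep-correct h m i p (tri≈ _ i≡m _) = mk⇔
  (λ (descent , word , linked) →
    to (descent-N h i p) descent , to (word-least i≡m) word , Linked.tail linked)
  (λ (descent , word , linked) →
    from (descent-N h i p) descent , from (word-least i≡m) word ,
    linked-N i p (subst (λ k → All (λ j → k < toℕ j) (φ p)) (sym i≡m) (lower word)) linked)
freeStep-correct h m i p (tri> _ _ m<i) = mk⇔
  (λ (descent , word , linked) → to (descent-N h i p) descent , (m<i , word) , linked)
  (λ (descent , (_ , word) , linked) → from (descent-N h i p) descent , word , linked)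

pendingStep-correct : ∀ h m (c i : Fin n) p i≟m c≟1+m →
  ⟦ pending h m c ⟧ (N i ∷ p) ⇔ ⟦ pendingStep h m c i i≟m c≟1+m ⟧ p
pendingStep-correct h m c i p (no i≢m) _ = mk⇔
  (λ (_ , (m<c , word) , _) → i≢m (word-forces-least m<c word)) ⊥-elim
pendingStep-correct h m c i p (yes i≡m) (yes c≡1+m) = mk⇔
  (λ (descent , (m<c , word) , linked) →
    to (descent-N h i p) descent , to (word-least c≡1+m) (to (word-swap i≡m m<c) word) , Linked.tail linked)
  (λ (descent , word , linked) →
    let m<c = ≤-reflexive (sym c≡1+m) in
    from (descent-N h i p) descent ,
    (m<c , from (word-swap i≡m m<c) (from (word-least c≡1+m) word)) ,
    linked-N i p (subst (λ k → All (λ j → k < toℕ j) (φ p)) (sym i≡m) (All.map <⇒≤ (lower word))) linked)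
pendingStep-correct h m c i p (yes i≡m) (no c≢1+m) = mk⇔
  (λ (descent , (m<c , word) , linked) →
    to (descent-N h i p) descent ,
    (≤∧≢⇒< m<c (c≢1+m ∘ sym) , to (word-swap i≡m m<c) word) , Linked.tail linked)
  (λ (descent , (1+m<c , word) , linked) →
    from (descent-N h i p) descent ,
    (<⇒≤ 1+m<c , from (word-swap i≡m (<⇒≤ 1+m<c)) word) ,
    linked-N i p (subst (λ k → All (λ j → k < toℕ j) (φ p)) (sym i≡m) (All.tail (lower word))) linked)

-- `δ` computes the left quotient (Brzozowski derivative) of the language by a step.
δ-correct : ∀ s (st : State n) p → ⟦ st ⟧ (s ∷ p) ⇔ ⟦ δ s st ⟧ p
δ-correct E     (free zero m)         p = mk⇔ (¬descent-E p ∘ proj₁) ⊥-elim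
δ-correct E     (free (suc h) m)      p = mk⇔
  (λ (descent , word , linked) → to (descent-E h p) descent , word , Linked.tail linked)
  (λ (descent , word , linked) → from (descent-E h p) descent , word , linked-E p linked)
δ-correct E     (fresh zero m c)      p = mk⇔ (¬descent-E p ∘ proj₁) ⊥-elim
δ-correct E     (fresh (suc h) m c)   p = mk⇔
  (λ (descent , word , linked) → to (descent-E h p) descent , word , Linked.tail (Linked.tail linked))
  (λ (descent , word , linked) → from (descent-E h p) descent , word , tt ∷ linked-E p linked)
δ-correct E     (pending zero m c)    p = mk⇔ (¬descent-E p ∘ proj₁) ⊥-elim
δ-correct E     (pending (suc h) m c) p = mk⇔
  (λ (descent , word , linked) → to (descent-E h p) descent , word , Linked.tail linked)
  (λ (descent , word , linked) → from (descent-E h p) descent , word , linked-E p linked)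
δ-correct E     dead                  p = mk⇔ ⊥-elim ⊥-elim
δ-correct (N i) (free h m)            p = freeStep-correct h m i p _
-- Consecutive north steps require c < i, whereas the unfinished block forces i = m < c.
δ-correct (N i) (fresh h m c)         p = mk⇔
  (λ (_ , (m<c , word) , linked) →
    <-asym m<c (subst (toℕ c <_) (word-forces-least m<c word) (Linked.head linked)))
  ⊥-elim
δ-correct (N i) (pending h m c)       p = pendingStep-correct h m c i p _ _
δ-correct (N i) dead                  p = mk⇔ ⊥-elim ⊥-elim

avoidingParkingFunction⇔free : (p : List (Step n)) →
  IsAvoidingParkingFunction (ρ₂₃₁ ∷ ρ₃₂₁ ∷ []) p ⇔ ⟦ free 0 0 ⟧ p
avoidingParkingFunction⇔free {n} p = mk⇔
  (λ (((end , above) , permutation , linked) , avoids) →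
    (trans (cong proj₂ end) (sym (cong proj₁ end)) , above) ,
    to (avoidingPermutation⇔word (φ p)) (permutation , avoids) , linked)
  (λ ((end , above) , word , linked) →
    let permutation , avoids = from (avoidingPermutation⇔word (φ p)) word
        -- `Descent 0` only equates the two coordinates of the endpoint; their value n comes from
        -- the number of labels.
        norths = trans (norths≡length p) (length-permutation {π = φ p} permutation)
    in ((cong₂ _,_ (trans (sym end) norths) norths , above) , permutation , linked) , avoids)
  where
  norths≡length : (p : List (Step n)) → proj₂ (endpoint p) ≡ length (φ p)
  norths≡length []        = refl
  norths≡length (N _ ∷ p) = cong suc (norths≡length p)
  norths≡length (E ∷ p)   = norths≡length p

⟦_⟧[]? : (st : State n) → Dec (⟦ st ⟧ [])
⟦_⟧[]? {n} (free h m) = map′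
  (λ { (refl , n≤m) → (refl , z≤n ∷ []) , from word-[] n≤m , [] })
  (λ ((end , _) , word , _) → trans (sym (+-identityʳ h)) end , to word-[] word)
  (h ≟ 0 ×-dec n ≤? m)
⟦ fresh h m c ⟧[]?   = no λ (_ , (m<c , word) , _) → ¬word-singleton m<c word
⟦ pending h m c ⟧[]? = no λ (_ , (m<c , word) , _) → ¬word-singleton m<c word
⟦ dead ⟧[]?          = no ⊥-elim

⟦_⟧? : (st : State n) → Decidable ⟦ st ⟧
⟦ st ⟧? []      = ⟦ st ⟧[]?
⟦ st ⟧? (s ∷ p) = map′ (from (δ-correct s st p)) (to (δ-correct s st p)) (⟦ δ s st ⟧? p)

-- Counting accepted paths by their first step

length-filter-map : ∀ {A B : Set} {P : B → Set} (P? : Decidable P) (f : A → B) xs →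
  length (filter P? (map f xs)) ≡ length (filter (P? ∘ f) xs)
length-filter-map P? f []       = refl
length-filter-map P? f (x ∷ xs) with does (P? (f x))
... | true  = cong suc (length-filter-map P? f xs)
... | false = length-filter-map P? f xs

length-filter-product : ∀ {A : Set} {P : List A → Set} (P? : Decidable P) xs yss →
  length (filter P? (cartesianProductWith _∷_ xs yss)) ≡
  sum (map (λ x → length (filter (P? ∘ (x ∷_)) yss)) xs)
length-filter-product P? []       yss = refl
length-filter-product P? (x ∷ xs) yss = begin
  length (filter P? (map (x ∷_) yss ++ cartesianProductWith _∷_ xs yss))
    ≡⟨ cong length (filter-++ P? (map (x ∷_) yss) _) ⟩
  length (filter P? (map (x ∷_) yss) ++ filter P? (cartesianProductWith _∷_ xs yss))
    ≡⟨ length-++ (filter P? (map (x ∷_) yss)) ⟩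
  length (filter P? (map (x ∷_) yss)) + length (filter P? (cartesianProductWith _∷_ xs yss))
    ≡⟨ cong₂ _+_ (length-filter-map P? (x ∷_) yss) (length-filter-product P? xs yss) ⟩
  length (filter (P? ∘ (x ∷_)) yss) + sum (map (λ x → length (filter (P? ∘ (x ∷_)) yss)) xs) ∎

number : State n → ℕ → ℕ
number {n} st k = length (filter ⟦ st ⟧? (paths n k))

number-suc : ∀ (st : State n) k →
  number st (suc k) ≡ number (δ E st) k + sum (tabulate λ i → number (δ (N i) st) k)
number-suc {n} st k = begin
  number st (suc k)
    ≡⟨ length-filter-product ⟦ st ⟧? (steps n) (paths n k) ⟩
  sum (map (λ s → length (filter (⟦ st ⟧? ∘ (s ∷_)) (paths n k))) (steps n))
    ≡⟨ cong sum (map-cong (λ s → cong length (filter-≐ (⟦ st ⟧? ∘ (s ∷_)) ⟦ δ s st ⟧?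
         (to (δ-correct s st _) , from (δ-correct s st _)) (paths n k))) (steps n)) ⟩
  number (δ E st) k + sum (map (λ s → number (δ s st) k) (map N (allFin n)))
    ≡⟨ cong (λ ns → number (δ E st) k + sum ns) (map-∘ (allFin n)) ⟨
  number (δ E st) k + sum (map (λ i → number (δ (N i) st) k) (allFin n))
    ≡⟨ cong (λ ns → number (δ E st) k + sum ns) (map-tabulate id (λ i → number (δ (N i) st) k)) ⟩
  number (δ E st) k + sum (tabulate λ i → number (δ (N i) st) k) ∎

number-dead : ∀ k → number {n} dead k ≡ 0
number-dead {n} k = cong length (filter-none ⟦ dead ⟧? (All.tabulate {xs = paths n k} λ _ ()))

sum-zero : ∀ {n} (f : Fin n → ℕ) → (∀ i → f i ≡ 0) → sum (tabulate f) ≡ 0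
sum-zero {zero}  f f≗0 = refl
sum-zero {suc n} f f≗0 = cong₂ _+_ (f≗0 zero) (sum-zero (f ∘ suc) (f≗0 ∘ suc))

sum-tabulate-Σ : ∀ {n} (f : Fin n → ℕ) v → (∀ i → f i ≡ v (toℕ i)) → sum (tabulate f) ≡ Σ[ n ] v
sum-tabulate-Σ {zero}  f v f≗v = refl
sum-tabulate-Σ {suc n} f v f≗v = cong₂ _+_ (f≗v zero) (sum-tabulate-Σ (f ∘ suc) (v ∘ suc) (f≗v ∘ suc))

sum-split : ∀ {n} m r → m + suc r ≡ n → (f : Fin n → ℕ) (v : ℕ → ℕ) {x : ℕ} →
  (∀ i → toℕ i < m → f i ≡ 0) →
  (∀ i → toℕ i ≡ m → f i ≡ x) →
  (∀ i j → toℕ i ≡ m + suc j → f i ≡ v j) →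
  sum (tabulate f) ≡ x + Σ[ r ] v
sum-split zero    r refl f v below at above =
  cong₂ _+_ (at zero refl) (sum-tabulate-Σ (f ∘ suc) v (λ i → above (suc i) (toℕ i) refl))
sum-split (suc m) r refl f v below at above = cong₂ _+_ (below zero (s≤s z≤n))
  (sum-split m r refl (f ∘ suc) v
    (λ i i<m → below (suc i) (s≤s i<m))
    (λ i i≡m → at (suc i) (cong suc i≡m))
    (λ i j i≡m+1+j → above (suc i) j (cong suc i≡m+1+j)))

-- The automaton obeys the recurrences

number-free : ∀ r h m k → m + r ≡ n → k ≡ h + (r + r) → number {n} (free h m) k ≡ completions 0 h r
number-free-N : ∀ r h m k → m + suc r ≡ n → k ≡ h + (r + suc r) →
  sum (tabulate λ i → number {n} (δ (N i) (free h m)) k) ≡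
  completions 0 (suc h) r + Σ[ r ] (λ j → completions (suc j) h r)
number-fresh : ∀ r h m c j k → m + suc r ≡ n → toℕ c ≡ m + suc j → k ≡ h + (r + suc r) →
  number {n} (fresh (suc h) m c) k ≡ completions (suc j) h r
number-pending : ∀ r h m c j k → m + suc r ≡ n → toℕ c ≡ m + suc j → k ≡ h + (r + r) →
  number {n} (pending h m c) k ≡ completions (suc j) h r
number-pending-N : ∀ r h m c j k → m + suc (suc r) ≡ n → toℕ c ≡ m + suc j → k ≡ h + (r + suc r) →
  sum (tabulate λ i → number {n} (δ (N i) (pending h m c)) k) ≡ completions j (suc h) r

1+h+2r : ∀ h r → h + (r + suc r) ≡ suc h + (r + r)
1+h+2r = solve-∀

number-free zero zero m k m+0≡n refl = cong length
  (filter-accept ⟦ free 0 m ⟧?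
    ((refl , z≤n ∷ []) , from word-[] (≤-reflexive (trans (sym m+0≡n) (+-identityʳ m))) , []))
number-free zero (suc h) m k m+0≡n refl = trans (number-suc (free (suc h) m) (h + 0))
  (cong₂ _+_ (number-free zero h m _ m+0≡n refl) (sum-zero _ below))
  where
  below : ∀ i → number (δ (N i) (free (suc h) m)) (h + 0) ≡ 0
  below i with <-cmp (toℕ i) m
  ... | tri< _ _ _    = number-dead (h + 0)
  ... | tri≈ i≮m _ _ = contradiction (subst (toℕ i <_) (trans (sym m+0≡n) (+-identityʳ m)) (toℕ<n i)) i≮m
  ... | tri> i≮m _ _ = contradiction (subst (toℕ i <_) (trans (sym m+0≡n) (+-identityʳ m)) (toℕ<n i)) i≮m
number-free (suc r) zero m k eq refl = trans (number-suc (free 0 m) (r + suc r))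
  (cong₂ _+_ (number-dead (r + suc r)) (number-free-N r 0 m _ eq refl))
number-free (suc r) (suc h) m k eq refl = trans (number-suc (free (suc h) m) (h + suc (r + suc r)))
  (cong₂ _+_ (number-free (suc r) h m _ eq refl) (number-free-N r (suc h) m _ eq (+-suc h (r + suc r))))

number-free-N {n} r h m k eq k≡ = sum-split m r eq _ _ below at above
  where
  below : ∀ i → toℕ i < m → number {n} (δ (N i) (free h m)) k ≡ 0
  below i i<m with <-cmp (toℕ i) m
  ... | tri< _ _ _    = number-dead k
  ... | tri≈ i≮m _ _ = contradiction i<m i≮m
  ... | tri> i≮m _ _ = contradiction i<m i≮m
  at : ∀ i → toℕ i ≡ m → number {n} (δ (N i) (free h m)) k ≡ completions 0 (suc h) r
  at i i≡m with <-cmp (toℕ i) m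
  ... | tri< _ i≢m _ = contradiction i≡m i≢m
  ... | tri≈ _ _ _   = number-free r (suc h) (suc m) k (trans (sym (+-suc m r)) eq) (trans k≡ (1+h+2r h r))
  ... | tri> _ i≢m _ = contradiction i≡m i≢m
  above : ∀ i j → toℕ i ≡ m + suc j → number {n} (δ (N i) (free h m)) k ≡ completions (suc j) h r
  above i j i≡ with <-cmp (toℕ i) m
  ... | tri< _ _ m≮i = contradiction (subst (m <_) (sym i≡) (m<m+n m (s≤s z≤n))) m≮i
  ... | tri≈ _ _ m≮i = contradiction (subst (m <_) (sym i≡) (m<m+n m (s≤s z≤n))) m≮i
  ... | tri> _ _ _    = number-fresh r h m i j k eq i≡ k≡

number-fresh {n} r h m c j k eq c≡ refl = begin
  number (fresh (suc h) m c) (h + (r + suc r))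
    ≡⟨ cong (number (fresh (suc h) m c)) (1+h+2r h r) ⟩
  number (fresh (suc h) m c) (suc (h + (r + r)))
    ≡⟨ number-suc (fresh (suc h) m c) (h + (r + r)) ⟩
  number (pending h m c) (h + (r + r)) +
  sum (tabulate λ i → number (δ (N i) (fresh (suc h) m c)) (h + (r + r)))
    -- After a fresh c only an east step survives, which is why the height drops from h + 1 to h.
    ≡⟨ cong₂ _+_ (number-pending r h m c j _ eq c≡ refl)
         (sum-zero {n} (λ _ → number {n} dead (h + (r + r))) (λ _ → number-dead (h + (r + r)))) ⟩
  completions (suc j) h r + 0
    ≡⟨ +-identityʳ _ ⟩
  completions (suc j) h r ∎

-- Here n = m + 1, which leaves no room for c = m + 1 + j.
number-pending zero h m c j k eq c≡ _ = contradiction (toℕ<n c)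
  (≤⇒≯ (subst₂ _≤_ eq (sym c≡) (+-monoʳ-≤ m (s≤s z≤n))))
number-pending (suc r) zero m c j k eq c≡ refl = trans (number-suc (pending 0 m c) (r + suc r))
  (cong₂ _+_ (number-dead (r + suc r)) (number-pending-N r 0 m c j _ eq c≡ refl))
number-pending (suc r) (suc h) m c j k eq c≡ refl =
  trans (number-suc (pending (suc h) m c) (h + suc (r + suc r)))
  (cong₂ _+_ (number-pending (suc r) h m c j _ eq c≡ refl)
             (number-pending-N r (suc h) m c j _ eq c≡ (+-suc h (r + suc r))))

number-pending-N {n} r h m c j k eq c≡ k≡ = begin
  sum (tabulate λ i → number {n} (δ (N i) (pending h m c)) k)
    ≡⟨ sum-split m (suc r) eq _ _
         (λ i i<m → other i (<⇒≢ i<m)) least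
         (λ i l i≡ → other i (<⇒≢ (subst (m <_) (sym i≡) (m<m+n m (s≤s z≤n))) ∘ sym)) ⟩
  completions j (suc h) r + Σ[ suc r ] (λ _ → 0)
    ≡⟨ cong (λ a → completions j (suc h) r + a) (Σ-zero (suc r)) ⟩
  completions j (suc h) r + 0
    ≡⟨ +-identityʳ _ ⟩
  completions j (suc h) r ∎
  where
  other : ∀ i → toℕ i ≢ m → number {n} (δ (N i) (pending h m c)) k ≡ 0
  other i i≢m with toℕ i ≟ m
  ... | yes i≡m = contradiction i≡m i≢m
  ... | no _    = number-dead k
  -- Once m is read, j forced labels are left; the block closes exactly when j = 0, that is, when c
  -- = m + 1.
  after : ∀ j → toℕ c ≡ m + suc j → (c≟ : Dec (toℕ c ≡ suc m)) → ∀ i i≡m →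
    number {n} (pendingStep h m c i (yes i≡m) c≟) k ≡ completions j (suc h) r
  after zero    c≡ (yes _)    i _ = number-free r (suc h) (2 + m) k
    (trans (sym (trans (+-suc m (suc r)) (cong suc (+-suc m r)))) eq) (trans k≡ (1+h+2r h r))
  after zero    c≡ (no c≢1+m) i _ = contradiction (trans c≡ (+-comm m 1)) c≢1+m
  after (suc j) c≡ (yes c≡1+m) i _ = contradiction
    (trans (sym c≡1+m) (trans c≡ (+-suc m (suc j)))) (<⇒≢ (s≤s (m<m+n m (s≤s z≤n))))
  after (suc j) c≡ (no _)     i _ = number-pending r (suc h) (suc m) c j k
    (trans (sym (+-suc m (suc r))) eq) (trans c≡ (+-suc m (suc j))) (trans k≡ (1+h+2r h r))
  least : ∀ i → toℕ i ≡ m → number {n} (δ (N i) (pending h m c)) k ≡ completions j (suc h) r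
  least i i≡m with toℕ i ≟ m
  ... | yes i≡m = after j c≡ (toℕ c ≟ suc m) i i≡m
  ... | no i≢m  = contradiction i≡m i≢m

-- The count of parking functions

pf≡raney₁ : ∀ n → pf n (ρ₂₃₁ ∷ ρ₃₂₁ ∷ []) ≡ raney 1 n
pf≡raney₁ n = begin
  pf n (ρ₂₃₁ ∷ ρ₃₂₁ ∷ [])
    ≡⟨ cong length (filter-≐ (isAvoidingParkingFunction? (ρ₂₃₁ ∷ ρ₃₂₁ ∷ [])) ⟦ free 0 0 ⟧?
         (to (avoidingParkingFunction⇔free _) , from (avoidingParkingFunction⇔free _)) (paths n (n + n))) ⟩
  number {n} (free 0 0) (n + n)
    ≡⟨ number-free n 0 0 (n + n) refl refl ⟩
  completions 0 0 n
    ≡⟨ unforced₀≡raney₁ n ⟩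
  raney 1 n ∎

theorem27 : ∀ (n : ℕ) → n ≥ 1 →
    (+ pf n (ρ₂₃₁ ∷ ρ₃₂₁ ∷ [])) / 1 ≡ (+ ((3 * n) C n)) / (1 + 2 * n)
-- `mkℚᵘ` takes the denominator minus one, so `0` and `2 * n` encode 1 and 2n + 1; the fractions are
-- compared by cross-multiplication.
theorem27 n _ = fromℚᵘ-cong {mkℚᵘ (+ pf n (ρ₂₃₁ ∷ ρ₃₂₁ ∷ [])) 0} {mkℚᵘ (+ ((3 * n) C n)) (2 * n)} (*≡* (begin
  + pf n (ρ₂₃₁ ∷ ρ₃₂₁ ∷ []) ℤ.* + (1 + 2 * n)   ≡⟨ ℤ.pos-* (pf n (ρ₂₃₁ ∷ ρ₃₂₁ ∷ [])) (1 + 2 * n) ⟨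
  + (pf n (ρ₂₃₁ ∷ ρ₃₂₁ ∷ []) * (1 + 2 * n))     ≡⟨ cong (λ a → + (a * (1 + 2 * n))) (pf≡raney₁ n) ⟩
  + (raney 1 n * (1 + 2 * n))                   ≡⟨ cong +_ (*-comm (raney 1 n) _) ⟩
  + ((1 + 2 * n) * raney 1 n)                   ≡⟨ cong +_ ([1+2n]*raney₁≡[3n]Cn n) ⟩
  + ((3 * n) C n)                               ≡⟨ ℤ.*-identityʳ _ ⟨
  + ((3 * n) C n) ℤ.* + 1                       ∎))
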